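{- Let $k$ be a positive integer and let $\mathcal{A}$ be a monotone family of subsets of $[n]$ with all minterms of size at most $k$. Then for every $p\in[0,1]$, $$\mu_{p/2}(\mathcal{A})\ \ge\ \frac{1}{k2^{3k-1}}\,\mu_p(\mathcal{A}).$$
   Context: Let $[n]=\{0,1,\ldots,n\}$. For $p\in[0,1]$, $\mu_p(\mathcal{A})$ is the probability that a random subset of $[n]$, containing each element independently with probability $p$, belongs to $\mathcal{A}$. A family $\mathcal{A}$ is monotone if $A\in\mathcal{A}$ and $A\subset B\subseteq [n]$ imply $B\in\mathcal{A}$. A minterm of $\mathcal{A}$ is a member of $\mathcal{A}$ that is minimal with respect to inclusion. -}

module Defs where

open import Data.Bool.Base using (if_then_else_)
open import Data.Fin.Subset using (Subset; inside; outside; _⊆_)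
open import Data.Integer.Base using (1ℤ)
open import Data.List.Base as List using (List; []; _∷_; _++_; filter)
open import Data.Nat.Base as ℕ using (ℕ; zero; suc)
import Data.Nat.Properties as ℕ
open import Data.Product.Base using (∃-syntax; _×_; _,_)
open import Data.Rational.Base using (ℚ; 0ℚ; 1ℚ; ½; Positive; _+_; _*_; _-_; -_; ∣_∣; 1/_; _≤_; _<_; _/_)
open import Data.Rational.Properties
open import Data.Rational.Solver using (module +-*-Solver)
open import Data.Vec.Base as Vec using ([]; _∷_)
open import Level using (Level)
open import Relation.Binary.PropositionalEquality using (_≡_; refl; sym; trans; cong; subst)
open import Relation.Unary using (Pred; Decidable)

private
  variable
    ℓ : Level
    m : ℕ

-- Real numbers as Cauchy sequences of rationals.  The rate of
-- convergence is not prescribed, so the ring operations act termwise.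

IsCauchy : (ℕ → ℚ) → Set
IsCauchy x = ∀ (ε : ℚ) → 0ℚ < ε →
  ∃[ N ] (∀ i j → N ℕ.≤ i → N ℕ.≤ j → ∣ x i - x j ∣ < ε)

record ℝ : Set where
  constructor mkℝ
  field
    seq    : ℕ → ℚ
    cauchy : IsCauchy seq

open ℝ public

-- lim x ≤ lim y; two sequences represent the same real number exactly
-- when this holds in both directions.
infix 4 _≤ᵣ_
_≤ᵣ_ : ℝ → ℝ → Set
x ≤ᵣ y = ∀ (ε : ℚ) → 0ℚ < ε →
  ∃[ N ] (∀ i → N ℕ.≤ i → seq x i ≤ seq y i + ε)

private
  half-pos : ∀ {ε} → 0ℚ < ε → 0ℚ < ½ * ε
  half-pos {ε} 0<ε = subst (_< ½ * ε) (*-zeroʳ ½) (*-monoʳ-<-pos ½ 0<ε)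

  half+half : ∀ ε → ½ * ε + ½ * ε ≡ ε
  half+half ε = trans (sym (*-distribʳ-+ ε ½ ½)) (*-identityˡ ε)

  const-cauchy : ∀ q → IsCauchy (λ _ → q)
  const-cauchy q ε 0<ε = 0 , λ _ _ _ _ →
    subst (λ r → ∣ r ∣ < ε) (sym (+-inverseʳ q)) 0<ε

  neg-cauchy : ∀ {x} → IsCauchy x → IsCauchy (λ i → - x i)
  neg-cauchy {x} cx ε 0<ε with cx ε 0<ε
  ... | N , h = N , λ i j p q → subst (_< ε)
    (trans (sym (∣-p∣≡∣p∣ (x i - x j))) (cong ∣_∣ (neg-distrib-+ (x i) (- x j)))) (h i j p q)

  +-cauchy : ∀ {x y} → IsCauchy x → IsCauchy y → IsCauchy (λ i → x i + y i)
  +-cauchy {x} {y} cx cy ε 0<ε with cx (½ * ε) (half-pos 0<ε) | cy (½ * ε) (half-pos 0<ε)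
  ... | M , h | N , k = M ℕ.⊔ N , λ i j p q →
    let open ≤-Reasoning in begin-strict
    ∣ (x i + y i) - (x j + y j) ∣    ≡⟨ cong ∣_∣ (rearrange (x i) (y i) (x j) (y j)) ⟩
    ∣ (x i - x j) + (y i - y j) ∣    ≤⟨ ∣p+q∣≤∣p∣+∣q∣ (x i - x j) (y i - y j) ⟩
    ∣ x i - x j ∣ + ∣ y i - y j ∣    <⟨ +-mono-<
      (h i j (ℕ.m⊔n≤o⇒m≤o M N p) (ℕ.m⊔n≤o⇒m≤o M N q))
      (k i j (ℕ.m⊔n≤o⇒n≤o M N p) (ℕ.m⊔n≤o⇒n≤o M N q)) ⟩
    ½ * ε + ½ * ε                    ≡⟨ half+half ε ⟩
    ε                                ∎
    where
    open +-*-Solver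
    rearrange : ∀ a b c d → (a + b) - (c + d) ≡ (a - c) + (b - d)
    rearrange = solve 4 (λ a b c d → (a :+ b) :- (c :+ d) := (a :- c) :+ (b :- d)) refl

  eventually-bounded : ∀ {x} → IsCauchy x →
    ∃[ N ] ∃[ B ] (Positive B × (∀ i → N ℕ.≤ i → ∣ x i ∣ ≤ B))
  eventually-bounded {x} cx with cx 1ℚ (positive⁻¹ 1ℚ)
  ... | N , h = N , 1ℚ + ∣ x N ∣ , pos+nonNeg⇒pos 1ℚ ∣ x N ∣ {{∣-∣-nonNeg (x N)}} , λ i p →
    let open ≤-Reasoning in begin
    ∣ x i ∣                     ≡⟨ cong ∣_∣ (split (x i) (x N)) ⟩
    ∣ (x i - x N) + x N ∣       ≤⟨ ∣p+q∣≤∣p∣+∣q∣ (x i - x N) (x N) ⟩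
    ∣ x i - x N ∣ + ∣ x N ∣     ≤⟨ +-monoˡ-≤ ∣ x N ∣ (<⇒≤ (h i N p ℕ.≤-refl)) ⟩
    1ℚ + ∣ x N ∣                ∎
    where
    open +-*-Solver
    split : ∀ a b → a ≡ (a - b) + b
    split = solve 2 (λ a b → a := (a :- b) :+ b) refl

  invert-scale : ∀ D → .{{Positive D}} → ∀ ε → 0ℚ < ε → ∃[ δ ] (0ℚ < δ × D * δ ≡ ε)
  invert-scale D ε 0<ε = r * ε , r*ε>0 , D*rε
    where
    instance
      D≢0 = pos⇒nonZero D
    r : ℚ
    r = 1/ D
    r*ε>0 : 0ℚ < r * ε
    r*ε>0 = subst (_< r * ε) (*-zeroʳ r) (*-monoʳ-<-pos r {{1/pos⇒pos D}} 0<ε)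
    D*rε : D * (r * ε) ≡ ε
    D*rε = trans (sym (*-assoc D r ε)) (trans (cong (_* ε) (*-inverseʳ D)) (*-identityˡ ε))

  ∣a*b∣<D*δ : ∀ a b D δ → .{{Positive D}} → ∣ a ∣ ≤ D → ∣ b ∣ < δ → ∣ a * b ∣ < D * δ
  ∣a*b∣<D*δ a b D δ a≤D b<δ = let open ≤-Reasoning in begin-strict
    ∣ a * b ∣      ≡⟨ ∣p*q∣≡∣p∣*∣q∣ a b ⟩
    ∣ a ∣ * ∣ b ∣  ≤⟨ *-monoʳ-≤-nonNeg ∣ b ∣ {{∣-∣-nonNeg b}} a≤D ⟩
    D * ∣ b ∣      <⟨ *-monoʳ-<-pos D b<δ ⟩
    D * δ          ∎

  ab-cd : ∀ a b c d → a * b - c * d ≡ a * (b - d) + d * (a - c)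
  ab-cd = solve 4 (λ a b c d → a :* b :- c :* d := a :* (b :- d) :+ d :* (a :- c)) refl
    where open +-*-Solver

  product-close : ∀ a b c d B C δ → .{{Positive B}} → .{{Positive C}} →
    ∣ a ∣ ≤ B → ∣ d ∣ ≤ C → ∣ b - d ∣ < δ → ∣ a - c ∣ < δ →
    ∣ a * b - c * d ∣ < (B + C) * δ
  product-close a b c d B C δ a≤B d≤C b-d<δ a-c<δ = let open ≤-Reasoning in begin-strict
    ∣ a * b - c * d ∣                  ≡⟨ cong ∣_∣ (ab-cd a b c d) ⟩
    ∣ a * (b - d) + d * (a - c) ∣      ≤⟨ ∣p+q∣≤∣p∣+∣q∣ (a * (b - d)) (d * (a - c)) ⟩
    ∣ a * (b - d) ∣ + ∣ d * (a - c) ∣  <⟨ +-mono-< {∣ a * (b - d) ∣} {B * δ} {∣ d * (a - c) ∣} {C * δ}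
      (∣a*b∣<D*δ a (b - d) B δ a≤B b-d<δ) (∣a*b∣<D*δ d (a - c) C δ d≤C a-c<δ) ⟩
    B * δ + C * δ                      ≡⟨ sym (*-distribʳ-+ δ B C) ⟩
    (B + C) * δ                        ∎

  *-cauchy : ∀ {x y} → IsCauchy x → IsCauchy y → IsCauchy (λ i → x i * y i)
  *-cauchy {x} {y} cx cy ε 0<ε =
    let K , B , B>0 , bx = eventually-bounded {x} cx
        L , C , C>0 , by = eventually-bounded {y} cy
        δ , δ>0 , total  = invert-scale (B + C) {{pos+pos⇒pos B {{B>0}} C {{C>0}}}} ε 0<ε
        M , hx           = cx δ δ>0
        N , hy           = cy δ δ>0
    in (K ℕ.⊔ L) ℕ.⊔ (M ℕ.⊔ N) , λ i j p q →
    let pKL = ℕ.m⊔n≤o⇒m≤o (K ℕ.⊔ L) (M ℕ.⊔ N) p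
        pMN = ℕ.m⊔n≤o⇒n≤o (K ℕ.⊔ L) (M ℕ.⊔ N) p
        qKL = ℕ.m⊔n≤o⇒m≤o (K ℕ.⊔ L) (M ℕ.⊔ N) q
        qMN = ℕ.m⊔n≤o⇒n≤o (K ℕ.⊔ L) (M ℕ.⊔ N) q
    in subst (∣ x i * y i - x j * y j ∣ <_) total
      (product-close (x i) (y i) (x j) (y j) B C δ {{B>0}} {{C>0}}
        (bx i (ℕ.m⊔n≤o⇒m≤o K L pKL)) (by j (ℕ.m⊔n≤o⇒n≤o K L qKL))
        (hy i j (ℕ.m⊔n≤o⇒n≤o M N pMN) (ℕ.m⊔n≤o⇒n≤o M N qMN))
        (hx i j (ℕ.m⊔n≤o⇒m≤o M N pMN) (ℕ.m⊔n≤o⇒m≤o M N qMN)))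

fromℚ : ℚ → ℝ
fromℚ q = mkℝ (λ _ → q) (const-cauchy q)

0ᵣ 1ᵣ : ℝ
0ᵣ = fromℚ 0ℚ
1ᵣ = fromℚ 1ℚ

infix  8 -ᵣ_
infixl 7 _*ᵣ_
infixl 6 _+ᵣ_ _-ᵣ_

-ᵣ_ : ℝ → ℝ
-ᵣ x = mkℝ (λ i → - seq x i) (neg-cauchy {seq x} (cauchy x))

_+ᵣ_ _*ᵣ_ _-ᵣ_ : ℝ → ℝ → ℝ
x +ᵣ y = mkℝ (λ i → seq x i + seq y i) (+-cauchy {seq x} {seq y} (cauchy x) (cauchy y))
x *ᵣ y = mkℝ (λ i → seq x i * seq y i) (*-cauchy {seq x} {seq y} (cauchy x) (cauchy y))
x -ᵣ y = x +ᵣ (-ᵣ y)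

sumᵣ : List ℝ → ℝ
sumᵣ = List.foldr _+ᵣ_ 0ᵣ

Monotone : Pred (Subset m) ℓ → Set ℓ
Monotone 𝒜 = ∀ {A B} → 𝒜 A → A ⊆ B → 𝒜 B

IsMinterm : Pred (Subset m) ℓ → Subset m → Set ℓ
IsMinterm 𝒜 S = 𝒜 S × (∀ {T} → 𝒜 T → T ⊆ S → T ≡ S)

subsets : ∀ m → List (Subset m)
subsets zero    = [] ∷ []
subsets (suc m) = List.map (outside ∷_) (subsets m) ++ List.map (inside ∷_) (subsets m)

-- The probability that the random subset equals S, by independence: a
-- factor p for each element of S and 1 - p for each element outside S.
weight : ℝ → Subset m → ℝ
weight p S = Vec.foldr′ _*ᵣ_ 1ᵣ (Vec.map (λ s → if s then p else 1ᵣ -ᵣ p) S)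

μ : ℝ → {𝒜 : Pred (Subset m) ℓ} → Decidable 𝒜 → ℝ
μ {m = m} p 𝒜? = sumᵣ (List.map (weight p) (filter 𝒜? (subsets m)))

-- 1 / (k 2^(3k-1)); the truncated subtraction is exact because k ≥ 1.
constant : (k : ℕ) .{{_ : ℕ.NonZero k}} → ℚ
constant k {{k≢0}} = (1ℤ / (k ℕ.* 2 ℕ.^ (3 ℕ.* k ℕ.∸ 1)))
  {{ℕ.m*n≢0 k (2 ℕ.^ (3 ℕ.* k ℕ.∸ 1)) {{k≢0}} {{ℕ.m^n≢0 2 (3 ℕ.* k ℕ.∸ 1)}}}}

{-# OPTIONS --safe #-}

-- A p/2-random set is distributed as a uniformly random subset T of a
-- p-random set S.  If S ∈ 𝒜 then S contains a minterm M, and T ⊇ M with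
-- probability 2^-∣M∣ ≥ 2^-k.  Hence μ_{p/2}(𝒜) ≥ 2^-k μ_p(𝒜), which is
-- stronger than the claim because k 2^(3k-1) ≥ 2^k.
module Submission where

open import Data.Fin.Subset using (Subset; ∣_∣)
open import Data.Nat.Base using (ℕ; suc; _≤_; NonZero)
open import Data.Rational.Base using (½)
open import Level using (Level)
open import Relation.Unary using (Pred; Decidable)
open import Defs

open import Data.Bool.Base using (if_then_else_; true; false)
open import Data.Fin.Subset using (inside; outside; _⊆_; _⊂_)
open import Data.Fin.Subset.Induction using (Acc; acc; ⊂-wellFounded)
open import Data.Fin.Subset.Properties using (_∈?_; _⊂?_; anySubset?; drop-∷-⊆; out⊆; s⊆s; ⊆-antisym; ⊆-refl; ⊆-trans; p⊂q⇒p⊆q)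
open import Data.Integer.Base using (1ℤ; +≤+)
import Data.Integer.Properties as ℤ
open import Data.List.Base as List using (List; []; _∷_; _++_; filter)
open import Data.List.Properties using (filter-++)
open import Data.Nat.Base as ℕ using (zero)
import Data.Nat.Properties as ℕ
open import Data.Product.Base using (∃-syntax; _×_; _,_)
open import Data.Rational.Base as ℚ using (ℚ; 0ℚ; 1ℚ; Positive; _+_; _*_; _-_; -_; 1/_)
open import Data.Rational.Properties
open import Data.Rational.Solver using (module +-*-Solver)
open import Data.Rational.Unnormalised.Base as ℚᵘ using (mkℚᵘ; *≤*)
import Data.Rational.Unnormalised.Properties as ℚᵘ
open import Data.Sum.Base using (inj₁; inj₂)
open import Data.Vec.Base using ([]; _∷_; here)
open import Function.Base using (_∘_)
open import Relation.Binary.PropositionalEquality using (_≡_; refl; sym; trans; cong; cong₂; subst; module ≡-Reasoning)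
open import Relation.Nullary using (contradiction)
open import Relation.Nullary.Decidable using (does; yes; no; decidable-stable; _×-dec_)

private
  variable
    ℓ : Level
    m : ℕ

-- Rational estimates for Cauchy sequences.

0≤p+q : ∀ {p q} → 0ℚ ℚ.≤ p → 0ℚ ℚ.≤ q → 0ℚ ℚ.≤ p + q
0≤p+q = +-mono-≤

0≤p*q : ∀ {p q} → 0ℚ ℚ.≤ p → 0ℚ ℚ.≤ q → 0ℚ ℚ.≤ p * q
0≤p*q {p} {q} 0≤p 0≤q = nonNegative⁻¹ (p * q)
  {{nonNeg*nonNeg⇒nonNeg p {{ℚ.nonNegative 0≤p}} q {{ℚ.nonNegative 0≤q}}}}

p≤q⇒0≤q-p : ∀ {p q} → p ℚ.≤ q → 0ℚ ℚ.≤ q - p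
p≤q⇒0≤q-p {p} {q} p≤q = subst (ℚ._≤ q - p) (+-inverseʳ p) (+-monoˡ-≤ (- p) p≤q)

0≤½ : 0ℚ ℚ.≤ ½
0≤½ = nonNegative⁻¹ ½

½*p+½*p : ∀ p → ½ * p + ½ * p ≡ p
½*p+½*p p = trans (sym (*-distribʳ-+ p ½ ½)) (*-identityˡ p)

0<½*p : ∀ {p} → 0ℚ ℚ.< p → 0ℚ ℚ.< ½ * p
0<½*p {p} 0<p = subst (ℚ._< ½ * p) (*-zeroʳ ½) (*-monoʳ-<-pos ½ 0<p)

positive-quotient : ∀ D → .{{Positive D}} → ∀ {ε} → 0ℚ ℚ.< ε → ∃[ δ ] (0ℚ ℚ.< δ × D * δ ≡ ε)
positive-quotient D {ε} 0<ε = r * ε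
  , subst (ℚ._< r * ε) (*-zeroʳ r) (*-monoʳ-<-pos r {{1/pos⇒pos D}} 0<ε)
  , trans (sym (*-assoc D r ε)) (trans (cong (_* ε) (*-inverseʳ D)) (*-identityˡ ε))
  where
  instance
    D≢0 = pos⇒nonZero D
  r : ℚ
  r = 1/ D

eventually-bounded-above : ∀ x → ∃[ B ] (Positive B × ∃[ N ] (∀ i → N ≤ i → seq x i ℚ.≤ B))
eventually-bounded-above x with cauchy x 1ℚ (positive⁻¹ 1ℚ)
... | N , close = 1ℚ + ℚ.∣ a ∣ , pos+nonNeg⇒pos 1ℚ ℚ.∣ a ∣ {{∣-∣-nonNeg a}} , N , λ i N≤i →
  let open ≤-Reasoning in begin
  seq x i                  ≡⟨ split (seq x i) a ⟩
  (seq x i - a) + a        ≤⟨ +-mono-≤ (≤-trans (p≤∣p∣ (seq x i - a)) (<⇒≤ (close i N N≤i ℕ.≤-refl))) (p≤∣p∣ a) ⟩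
  1ℚ + ℚ.∣ a ∣             ∎
  where
  a = seq x N
  split : ∀ a b → a ≡ (a - b) + b
  split = solve 2 (λ a b → a := (a :- b) :+ b) refl
    where open +-*-Solver
  p≤∣p∣ : ∀ p → p ℚ.≤ ℚ.∣ p ∣
  p≤∣p∣ p with ≤-total 0ℚ p
  ... | inj₁ 0≤p = ≤-reflexive (sym (0≤p⇒∣p∣≡p 0≤p))
  ... | inj₂ p≤0 = ≤-trans p≤0 (0≤∣p∣ p)

-- The right-hand side equals `(x + a) * (y + b) + b * (B - x) + a * (C - y)`, a sum of three
-- products of nonnegative factors. This covers `x` and `y` that are themselves slightly negative.
approximate-product-nonneg : ∀ {x y a b B C} → 0ℚ ℚ.≤ a → 0ℚ ℚ.≤ b →
  0ℚ ℚ.≤ x + a → 0ℚ ℚ.≤ y + b → x ℚ.≤ B → y ℚ.≤ C →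
  0ℚ ℚ.≤ x * y + (C * a + (B + a) * b)
approximate-product-nonneg {x} {y} {a} {b} {B} {C} 0≤a 0≤b 0≤x+a 0≤y+b x≤B y≤C =
  subst (0ℚ ℚ.≤_) (expand x y a b B C)
    (0≤p+q (0≤p+q (0≤p*q 0≤x+a 0≤y+b) (0≤p*q 0≤b (p≤q⇒0≤q-p x≤B))) (0≤p*q 0≤a (p≤q⇒0≤q-p y≤C)))
  where
  expand : ∀ x y a b B C →
    (x + a) * (y + b) + b * (B - x) + a * (C - y) ≡ x * y + (C * a + (B + a) * b)
  expand = solve 6 (λ x y a b B C →
    (x :+ a) :* (y :+ b) :+ b :* (B :- x) :+ a :* (C :- y) := x :* y :+ (C :* a :+ (B :+ a) :* b)) refl
    where open +-*-Solver

-- Nonnegative reals under sums and products.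

0≤x*ᵣy : ∀ x y → 0ᵣ ≤ᵣ x → 0ᵣ ≤ᵣ y → 0ᵣ ≤ᵣ x *ᵣ y
0≤x*ᵣy x y 0≤x 0≤y ε 0<ε =
  let B , B>0 , K , x≤B = eventually-bounded-above x
      C , C>0 , L , y≤C = eventually-bounded-above y
      -- The slacks satisfy `C * a ≡ ½ * ε` and `(B + a) * b ≡ ½ * ε`, so the total error is exactly
      -- `ε`. The slack `a` is fixed first because it occurs in the coefficient of `b`.
      a , 0<a , Ca≡     = positive-quotient C {{C>0}} (0<½*p 0<ε)
      B+a>0             = pos+pos⇒pos B {{B>0}} a {{ℚ.positive 0<a}}
      b , 0<b , Bb≡     = positive-quotient (B + a) {{B+a>0}} (0<½*p 0<ε)
      M , 0≤x+a         = 0≤x a 0<a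
      N , 0≤y+b         = 0≤y b 0<b
  in (K ℕ.⊔ L) ℕ.⊔ (M ℕ.⊔ N) , λ i le →
  let KL = ℕ.m⊔n≤o⇒m≤o (K ℕ.⊔ L) (M ℕ.⊔ N) le
      MN = ℕ.m⊔n≤o⇒n≤o (K ℕ.⊔ L) (M ℕ.⊔ N) le
  in subst (λ e → 0ℚ ℚ.≤ seq x i * seq y i + e) (trans (cong₂ _+_ Ca≡ Bb≡) (½*p+½*p ε))
    (approximate-product-nonneg {seq x i} {seq y i} (<⇒≤ 0<a) (<⇒≤ 0<b)
      (0≤x+a i (ℕ.m⊔n≤o⇒m≤o M N MN)) (0≤y+b i (ℕ.m⊔n≤o⇒n≤o M N MN))
      (x≤B i (ℕ.m⊔n≤o⇒m≤o K L KL)) (y≤C i (ℕ.m⊔n≤o⇒n≤o K L KL)))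

0≤x+ᵣy : ∀ x y → 0ᵣ ≤ᵣ x → 0ᵣ ≤ᵣ y → 0ᵣ ≤ᵣ x +ᵣ y
0≤x+ᵣy x y 0≤x 0≤y ε 0<ε with 0≤x (½ * ε) (0<½*p 0<ε) | 0≤y (½ * ε) (0<½*p 0<ε)
... | M , hx | N , hy = M ℕ.⊔ N , λ i le →
  subst (0ℚ ℚ.≤_) (trans (rearrange (seq x i) (seq y i) (½ * ε)) (cong (seq x i + seq y i +_) (½*p+½*p ε)))
    (0≤p+q (hx i (ℕ.m⊔n≤o⇒m≤o M N le)) (hy i (ℕ.m⊔n≤o⇒n≤o M N le)))
  where
  rearrange : ∀ a b e → (a + e) + (b + e) ≡ (a + b) + (e + e)
  rearrange = solve 3 (λ a b e → (a :+ e) :+ (b :+ e) := (a :+ b) :+ (e :+ e)) refl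
    where open +-*-Solver

x≤ᵣ1⇒0≤1-x : ∀ x → x ≤ᵣ 1ᵣ → 0ᵣ ≤ᵣ 1ᵣ -ᵣ x
x≤ᵣ1⇒0≤1-x x x≤1 ε 0<ε with x≤1 ε 0<ε
... | N , h = N , λ i N≤i → subst (0ℚ ℚ.≤_) (rearrange (seq x i) ε) (p≤q⇒0≤q-p (h i N≤i))
  where
  rearrange : ∀ a e → (1ℚ + e) - a ≡ (1ℚ - a) + e
  rearrange = solve 2 (λ a e → (con 1ℚ :+ e) :- a := (con 1ℚ :- a) :+ e) refl
    where open +-*-Solver

-- Expectation over a random subset, and thinning.

𝔼 : ℝ → (Subset m → ℚ) → ℝ
𝔼 {zero}  p f = fromℚ (f [])
𝔼 {suc m} p f = (1ᵣ -ᵣ p) *ᵣ 𝔼 p (f ∘ (outside ∷_)) +ᵣ p *ᵣ 𝔼 p (f ∘ (inside ∷_))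

-- Each coordinate averages with the nonnegative weights `1ᵣ -ᵣ p` and `p`. The claim concerns the
-- limit only: single approximations of `p` may fall outside the unit interval, so a termwise
-- version could fail.
𝔼-nonneg : ∀ p → 0ᵣ ≤ᵣ p → p ≤ᵣ 1ᵣ → (f : Subset m → ℚ) → (∀ S → 0ℚ ℚ.≤ f S) → 0ᵣ ≤ᵣ 𝔼 p f
𝔼-nonneg {zero} p 0≤p p≤1 f 0≤f ε 0<ε = 0 , λ _ _ → 0≤p+q (0≤f []) (<⇒≤ 0<ε)
𝔼-nonneg {suc m} p 0≤p p≤1 f 0≤f = 0≤x+ᵣy ((1ᵣ -ᵣ p) *ᵣ E₀) (p *ᵣ E₁)
  (0≤x*ᵣy (1ᵣ -ᵣ p) E₀ (x≤ᵣ1⇒0≤1-x p p≤1) (𝔼-nonneg p 0≤p p≤1 _ (λ S → 0≤f (outside ∷ S))))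
  (0≤x*ᵣy p E₁ 0≤p (𝔼-nonneg p 0≤p p≤1 _ (λ S → 0≤f (inside ∷ S))))
  where
  E₀ = 𝔼 p (f ∘ (outside ∷_))
  E₁ = 𝔼 p (f ∘ (inside ∷_))

-- Real operations act termwise, so linearity is an exact equality of rationals at every index.
𝔼-linear : ∀ p i c d (f g : Subset m → ℚ) →
  seq (𝔼 p (λ S → c * f S + d * g S)) i ≡ c * seq (𝔼 p f) i + d * seq (𝔼 p g) i
𝔼-linear {zero} p i c d f g = refl
𝔼-linear {suc m} p i c d f g = trans
  (cong₂ (λ u v → (1ℚ - seq p i) * u + seq p i * v)
    (𝔼-linear p i c d (f ∘ (outside ∷_)) (g ∘ (outside ∷_)))
    (𝔼-linear p i c d (f ∘ (inside ∷_)) (g ∘ (inside ∷_))))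
  (rearrange (seq p i) c d _ _ _ _)
  where
  rearrange : ∀ p c d f₀ f₁ g₀ g₁ →
    (1ℚ - p) * (c * f₀ + d * g₀) + p * (c * f₁ + d * g₁)
      ≡ c * ((1ℚ - p) * f₀ + p * f₁) + d * ((1ℚ - p) * g₀ + p * g₁)
  rearrange = solve 7 (λ p c d f₀ f₁ g₀ g₁ →
    (con 1ℚ :- p) :* (c :* f₀ :+ d :* g₀) :+ p :* (c :* f₁ :+ d :* g₁)
      := c :* ((con 1ℚ :- p) :* f₀ :+ p :* f₁) :+ d :* ((con 1ℚ :- p) :* g₀ :+ p :* g₁)) refl
    where open +-*-Solver

-- The mean of `f` over a uniformly random subset of the argument: each of its elements is kept
-- independently with probability `½`.
thin : (Subset m → ℚ) → Subset m → ℚ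
thin f []            = f []
thin f (outside ∷ S) = thin (f ∘ (outside ∷_)) S
thin f (inside  ∷ S) = ½ * thin (f ∘ (outside ∷_)) S + ½ * thin (f ∘ (inside ∷_)) S

-- An element survives selection with probability `p` followed by thinning with probability `p/2`.
-- Per coordinate this is the identity `1 - q/2 = (1 - q) + q/2`.
𝔼-thin : ∀ p i (f : Subset m → ℚ) → seq (𝔼 (p *ᵣ fromℚ ½) f) i ≡ seq (𝔼 p (thin f)) i
𝔼-thin {zero} p i f = refl
𝔼-thin {suc m} p i f = begin
  (1ℚ - q * ½) * seq (𝔼 (p *ᵣ fromℚ ½) f₀) i + q * ½ * seq (𝔼 (p *ᵣ fromℚ ½) f₁) i
    ≡⟨ cong₂ (λ u v → (1ℚ - q * ½) * u + q * ½ * v) (𝔼-thin p i f₀) (𝔼-thin p i f₁) ⟩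
  (1ℚ - q * ½) * u + q * ½ * v
    ≡⟨ rearrange q u v ⟩
  (1ℚ - q) * u + q * (½ * u + ½ * v)
    ≡⟨ cong (λ w → (1ℚ - q) * u + q * w) (𝔼-linear p i ½ ½ (thin f₀) (thin f₁)) ⟨
  (1ℚ - q) * u + q * seq (𝔼 p (thin f ∘ (inside ∷_))) i
    ∎
  where
  open ≡-Reasoning
  q = seq p i
  f₀ = f ∘ (outside ∷_)
  f₁ = f ∘ (inside ∷_)
  u = seq (𝔼 p (thin f₀)) i
  v = seq (𝔼 p (thin f₁)) i
  rearrange : ∀ q u v → (1ℚ - q * ½) * u + q * ½ * v ≡ (1ℚ - q) * u + q * (½ * u + ½ * v)
  rearrange = solve 3 (λ q u v →
    (con 1ℚ :- q :* con ½) :* u :+ q :* con ½ :* v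
      := (con 1ℚ :- q) :* u :+ q :* (con ½ :* u :+ con ½ :* v)) refl
    where open +-*-Solver

thin-nonneg : (f : Subset m → ℚ) → (∀ S → 0ℚ ℚ.≤ f S) → ∀ S → 0ℚ ℚ.≤ thin f S
thin-nonneg f 0≤f []            = 0≤f []
thin-nonneg f 0≤f (outside ∷ S) = thin-nonneg _ (λ T → 0≤f (outside ∷ T)) S
thin-nonneg f 0≤f (inside  ∷ S) = 0≤p+q
  (0≤p*q 0≤½ (thin-nonneg _ (λ T → 0≤f (outside ∷ T)) S))
  (0≤p*q 0≤½ (thin-nonneg _ (λ T → 0≤f (inside ∷ T)) S))

½^_ : ℕ → ℚ
½^ zero  = 1ℚ
½^ suc n = ½ * ½^ n

-- A uniformly random subset of `S` contains `M` with probability `½^ ∣ M ∣`; there `f` is at least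
-- 1, and elsewhere it is nonnegative.
thin-lower-bound : ∀ (f : Subset m → ℚ) {M S} → (∀ T → 0ℚ ℚ.≤ f T) →
  (∀ T → M ⊆ T → 1ℚ ℚ.≤ f T) → M ⊆ S → ½^ ∣ M ∣ ℚ.≤ thin f S
thin-lower-bound f {[]} {[]} 0≤f 1≤f M⊆S = 1≤f [] M⊆S
thin-lower-bound f {outside ∷ M} {outside ∷ S} 0≤f 1≤f M⊆S =
  thin-lower-bound _ (λ T → 0≤f (outside ∷ T)) (λ T M⊆T → 1≤f (outside ∷ T) (out⊆ M⊆T)) (drop-∷-⊆ M⊆S)
-- Keeping or dropping an element outside `M` does not affect containment of `M`: both branches have
-- the same bound, and so does their average.
thin-lower-bound f {outside ∷ M} {inside ∷ S} 0≤f 1≤f M⊆S =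
  subst (ℚ._≤ thin f (inside ∷ S)) (½*p+½*p (½^ ∣ M ∣)) (+-mono-≤
    (*-monoˡ-≤-nonNeg ½ (thin-lower-bound _ (λ T → 0≤f (outside ∷ T))
      (λ T M⊆T → 1≤f (outside ∷ T) (out⊆ M⊆T)) (drop-∷-⊆ M⊆S)))
    (*-monoˡ-≤-nonNeg ½ (thin-lower-bound _ (λ T → 0≤f (inside ∷ T))
      (λ T M⊆T → 1≤f (inside ∷ T) (out⊆ M⊆T)) (drop-∷-⊆ M⊆S))))
thin-lower-bound f {inside ∷ M} {outside ∷ S} 0≤f 1≤f M⊆S with () ← M⊆S here
-- An element of `M` must be kept. The branch that drops it is bounded below by 0, which costs one
-- factor `½`.
thin-lower-bound f {inside ∷ M} {inside ∷ S} 0≤f 1≤f M⊆S =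
  subst (ℚ._≤ thin f (inside ∷ S)) (+-identityˡ (½^ ∣ inside ∷ M ∣)) (+-mono-≤
    (0≤p*q 0≤½ (thin-nonneg _ (λ T → 0≤f (outside ∷ T)) S))
    (*-monoˡ-≤-nonNeg ½ (thin-lower-bound _ (λ T → 0≤f (inside ∷ T))
      (λ T M⊆T → 1≤f (inside ∷ T) (s⊆s M⊆T)) (drop-∷-⊆ M⊆S))))

-- The measure as the expectation of an indicator.

indicator : {𝒜 : Pred (Subset m) ℓ} → Decidable 𝒜 → Subset m → ℚ
indicator 𝒜? S = if does (𝒜? S) then 1ℚ else 0ℚ

indicator-nonneg : {𝒜 : Pred (Subset m) ℓ} (𝒜? : Decidable 𝒜) → ∀ S → 0ℚ ℚ.≤ indicator 𝒜? S
indicator-nonneg 𝒜? S with does (𝒜? S)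
... | true  = nonNegative⁻¹ 1ℚ
... | false = ≤-refl

1≤indicator : {𝒜 : Pred (Subset m) ℓ} (𝒜? : Decidable 𝒜) → ∀ {S} → 𝒜 S → 1ℚ ℚ.≤ indicator 𝒜? S
1≤indicator 𝒜? {S} S∈𝒜 with 𝒜? S
... | yes _   = ≤-refl
... | no S∉𝒜 = contradiction S∈𝒜 S∉𝒜

sumOver : {A : Set} → (A → ℚ) → List A → ℚ
sumOver w = List.foldr (λ a s → w a + s) 0ℚ

sumOver-++ : {A : Set} (w : A → ℚ) → ∀ xs ys → sumOver w (xs ++ ys) ≡ sumOver w xs + sumOver w ys
sumOver-++ w []       ys = sym (+-identityˡ (sumOver w ys))
sumOver-++ w (x ∷ xs) ys = trans (cong (w x +_) (sumOver-++ w xs ys)) (sym (+-assoc (w x) (sumOver w xs) (sumOver w ys)))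

-- All sets in the sum share the first coordinate `b`, so its factor `c` comes out; for weights, `c`
-- is `1 - p` or `p`.
sumOver-filter-∷ : ∀ b c (w : Subset (suc m) → ℚ) (v : Subset m → ℚ) → (∀ S → w (b ∷ S) ≡ c * v S) →
  {𝒜 : Pred (Subset (suc m)) ℓ} (𝒜? : Decidable 𝒜) → ∀ xs →
  sumOver w (filter 𝒜? (List.map (b ∷_) xs)) ≡ c * sumOver v (filter (𝒜? ∘ (b ∷_)) xs)
sumOver-filter-∷ b c w v w≡cv 𝒜? [] = sym (*-zeroʳ c)
sumOver-filter-∷ b c w v w≡cv 𝒜? (S ∷ xs) with does (𝒜? (b ∷ S))
... | true  = trans (cong₂ _+_ (w≡cv S) (sumOver-filter-∷ b c w v w≡cv 𝒜? xs)) (sym (*-distribˡ-+ c (v S) _))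
... | false = sumOver-filter-∷ b c w v w≡cv 𝒜? xs

seq-sumᵣ-map : ∀ {A : Set} i (w : A → ℝ) xs → seq (sumᵣ (List.map w xs)) i ≡ sumOver (λ a → seq (w a) i) xs
seq-sumᵣ-map i w []       = refl
seq-sumᵣ-map i w (x ∷ xs) = cong (seq (w x) i +_) (seq-sumᵣ-map i w xs)

-- `subsets` lists the sets without the first element and then those with it, which matches the two
-- summands in the recursion of `𝔼`.
sumOver-weight : ∀ p i {𝒜 : Pred (Subset m) ℓ} (𝒜? : Decidable 𝒜) →
  sumOver (λ S → seq (weight p S) i) (filter 𝒜? (subsets m)) ≡ seq (𝔼 p (indicator 𝒜?)) i
sumOver-weight {zero} p i 𝒜? = singleton (λ S → seq (weight p S) i) refl
  where
  singleton : (w : Subset 0 → ℚ) → w [] ≡ 1ℚ → sumOver w (filter 𝒜? ([] ∷ [])) ≡ indicator 𝒜? []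
  singleton w w≡1 with does (𝒜? [])
  ... | true  = trans (+-identityʳ (w [])) w≡1
  ... | false = refl
sumOver-weight {suc m} p i 𝒜? = begin
  sumOver w (filter 𝒜? (Ss₀ ++ Ss₁))
    ≡⟨ cong (sumOver w) (filter-++ 𝒜? Ss₀ Ss₁) ⟩
  sumOver w (filter 𝒜? Ss₀ ++ filter 𝒜? Ss₁)
    ≡⟨ sumOver-++ w (filter 𝒜? Ss₀) (filter 𝒜? Ss₁) ⟩
  sumOver w (filter 𝒜? Ss₀) + sumOver w (filter 𝒜? Ss₁)
    ≡⟨ cong₂ _+_
         (sumOver-filter-∷ outside (1ℚ - seq p i) w v (λ _ → refl) 𝒜? (subsets m))
         (sumOver-filter-∷ inside (seq p i) w v (λ _ → refl) 𝒜? (subsets m)) ⟩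
  (1ℚ - seq p i) * sumOver v (filter (𝒜? ∘ (outside ∷_)) (subsets m))
    + seq p i * sumOver v (filter (𝒜? ∘ (inside ∷_)) (subsets m))
    ≡⟨ cong₂ (λ x y → (1ℚ - seq p i) * x + seq p i * y)
         (sumOver-weight p i (𝒜? ∘ (outside ∷_))) (sumOver-weight p i (𝒜? ∘ (inside ∷_))) ⟩
  seq (𝔼 p (indicator 𝒜?)) i ∎
  where
  open ≡-Reasoning
  Ss₀ = List.map (outside ∷_) (subsets m)
  Ss₁ = List.map (inside ∷_) (subsets m)
  w : Subset (suc m) → ℚ
  w S = seq (weight p S) i
  v : Subset m → ℚ
  v S = seq (weight p S) i

μ≡𝔼-indicator : ∀ p i {𝒜 : Pred (Subset m) ℓ} (𝒜? : Decidable 𝒜) →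
  seq (μ p 𝒜?) i ≡ seq (𝔼 p (indicator 𝒜?)) i
μ≡𝔼-indicator {m = m} p i 𝒜? =
  trans (seq-sumᵣ-map i (weight p) (filter 𝒜? (subsets m))) (sumOver-weight p i 𝒜?)

-- Descent along proper inclusion: while some proper subset lies in `𝒜`, pass to it. Decidability of
-- `𝒜` makes the search at each stage effective.
minterm-below : {𝒜 : Pred (Subset m) ℓ} → Decidable 𝒜 → ∀ S → 𝒜 S → ∃[ M ] (IsMinterm 𝒜 M × M ⊆ S)
minterm-below {𝒜 = 𝒜} 𝒜? S = go S (⊂-wellFounded S)
  where
  go : ∀ S → Acc _⊂_ S → 𝒜 S → ∃[ M ] (IsMinterm 𝒜 M × M ⊆ S)
  go S (acc rec) S∈𝒜 with anySubset? (λ T → 𝒜? T ×-dec T ⊂? S)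
  ... | yes (T , T∈𝒜 , T⊂S) =
    let M , minterm , M⊆T = go T (rec T⊂S) T∈𝒜 in M , minterm , ⊆-trans M⊆T (p⊂q⇒p⊆q T⊂S)
  -- `S` is minimal: a member `T ⊆ S` missing some `x` of `S` would be a proper subset in `𝒜`.
  ... | no ¬T = S , (S∈𝒜 , λ {T} T∈𝒜 T⊆S → ⊆-antisym T⊆S λ {x} x∈S →
    decidable-stable (x ∈? T) λ x∉T → ¬T (T , T∈𝒜 , T⊆S , x , x∈S , x∉T)) , ⊆-refl

-- The constant against powers of one half.

fromℚᵘ-mono-≤ : ∀ {p q} → p ℚᵘ.≤ q → ℚ.fromℚᵘ p ℚ.≤ ℚ.fromℚᵘ q
fromℚᵘ-mono-≤ {p} {q} p≤q = toℚᵘ-cancel-≤ (begin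
  ℚ.toℚᵘ (ℚ.fromℚᵘ p)  ≃⟨ toℚᵘ-fromℚᵘ p ⟩
  p                    ≤⟨ p≤q ⟩
  q                    ≃⟨ toℚᵘ-fromℚᵘ q ⟨
  ℚ.toℚᵘ (ℚ.fromℚᵘ q)  ∎)
  where open ℚᵘ.≤-Reasoning

1/-antimono-≤ : ∀ {a b} .{{_ : NonZero a}} .{{_ : NonZero b}} → a ≤ b → 1ℤ ℚ./ b ℚ.≤ 1ℤ ℚ./ a
-- `mkℚᵘ` stores the predecessor of the denominator, so the two fractions are `1/(1+b)` and
-- `1/(1+a)`.
1/-antimono-≤ {suc a} {suc b} a≤b = fromℚᵘ-mono-≤ {mkℚᵘ 1ℤ b} {mkℚᵘ 1ℤ a}
  (*≤* (ℤ.*-monoˡ-≤-nonNeg 1ℤ (+≤+ a≤b)))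

½*1/ : ∀ a .{{_ : NonZero a}} → ½ * (1ℤ ℚ./ a) ≡ (1ℤ ℚ./ (2 ℕ.* a)) {{ℕ.m*n≢0 2 a}}
½*1/ (suc a) = toℚᵘ-injective (begin-equality
  ℚ.toℚᵘ (½ * ℚ.fromℚᵘ r)          ≃⟨ toℚᵘ-homo-* ½ (ℚ.fromℚᵘ r) ⟩
  ℚ.toℚᵘ ½ ℚᵘ.* ℚ.toℚᵘ (ℚ.fromℚᵘ r) ≃⟨ ℚᵘ.*-congˡ (toℚᵘ-fromℚᵘ r) ⟩
  ℚ.toℚᵘ ½ ℚᵘ.* r                  ≃⟨ toℚᵘ-fromℚᵘ (ℚ.toℚᵘ ½ ℚᵘ.* r) ⟨
  ℚ.toℚᵘ (ℚ.fromℚᵘ (ℚ.toℚᵘ ½ ℚᵘ.* r)) ∎)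
  where
  open ℚᵘ.≤-Reasoning
  r = mkℚᵘ 1ℤ a

½^n≡1/2^n : ∀ n → ½^ n ≡ (1ℤ ℚ./ (2 ℕ.^ n)) {{ℕ.m^n≢0 2 n}}
½^n≡1/2^n zero    = refl
½^n≡1/2^n (suc n) = trans (cong (½ *_) (½^n≡1/2^n n)) (½*1/ (2 ℕ.^ n) {{ℕ.m^n≢0 2 n}})

-- Since `n ≤ k ≤ 3k-1`, the power `2^n` is at most `2^(3k-1)`, hence at most `k * 2^(3k-1)`; then
-- take reciprocals.
constant≤½^ : ∀ k .{{_ : NonZero k}} {n} → n ≤ k → constant k ℚ.≤ ½^ n
constant≤½^ k@(suc j) {n} n≤k = subst (constant k ℚ.≤_) (sym (½^n≡1/2^n n))
  (1/-antimono-≤ {{ℕ.m^n≢0 2 n}} {{ℕ.m*n≢0 k (2 ℕ.^ (3 ℕ.* k ℕ.∸ 1)) {{_}} {{ℕ.m^n≢0 2 (3 ℕ.* k ℕ.∸ 1)}}}}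
    (ℕ.≤-trans (ℕ.^-monoʳ-≤ 2 (ℕ.≤-trans n≤k k≤3k-1)) (ℕ.m≤n*m _ k)))
  where
  k≤3k-1 : k ≤ 3 ℕ.* k ℕ.∸ 1
  -- With `k = suc j`, the right side computes to `j + (k + (k + 0))`.
  k≤3k-1 = ℕ.≤-trans (ℕ.m≤m+n k (k ℕ.+ 0)) (ℕ.m≤n+m _ j)

-- The pointwise inequality and its expectation.

constant*indicator≤thin : ∀ k .{{_ : NonZero k}} {𝒜 : Pred (Subset m) ℓ} (𝒜? : Decidable 𝒜) →
  Monotone 𝒜 → (∀ S → IsMinterm 𝒜 S → ∣ S ∣ ≤ k) →
  ∀ S → constant k * indicator 𝒜? S ℚ.≤ thin (indicator 𝒜?) S
constant*indicator≤thin k 𝒜? mono small S with 𝒜? S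
... | no _ = subst (ℚ._≤ thin (indicator 𝒜?) S) (sym (*-zeroʳ (constant k)))
  (thin-nonneg (indicator 𝒜?) (indicator-nonneg 𝒜?) S)
... | yes S∈𝒜 with minterm-below 𝒜? S S∈𝒜
-- By monotonicity the indicator is 1 on every superset of `M`, as the thinning bound requires.
...   | M , minterm@(M∈𝒜 , _) , M⊆S = let open ≤-Reasoning in begin
  constant k * 1ℚ          ≡⟨ *-identityʳ (constant k) ⟩
  constant k               ≤⟨ constant≤½^ k (small M minterm) ⟩
  ½^ ∣ M ∣                 ≤⟨ thin-lower-bound (indicator 𝒜?) (indicator-nonneg 𝒜?)
                                (λ T M⊆T → 1≤indicator 𝒜? (mono M∈𝒜 M⊆T)) M⊆S ⟩
  thin (indicator 𝒜?) S    ∎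

corollary4p4 : ∀ {ℓ : Level} (n k : ℕ) .{{_ : NonZero k}}
    (𝒜 : Pred (Subset (suc n)) ℓ) (𝒜? : Decidable 𝒜) →
    Monotone 𝒜 →
    (∀ S → IsMinterm 𝒜 S → ∣ S ∣ ≤ k) →
    ∀ (p : ℝ) → 0ᵣ ≤ᵣ p → p ≤ᵣ 1ᵣ →
    fromℚ (constant k) *ᵣ μ p 𝒜? ≤ᵣ μ (p *ᵣ fromℚ ½) 𝒜?
corollary4p4 n k 𝒜 𝒜? mono small p 0≤p p≤1 ε 0<ε =
  -- The only limiting argument is here; every other step below is an exact equality at a fixed
  -- index or adds this inequality to a constant.
  let N , 0≤𝔼 = 𝔼-nonneg p 0≤p p≤1 excess 0≤excess ε 0<ε
  in N , λ i N≤i → let open ≤-Reasoning in begin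
  c * seq (μ p 𝒜?) i                            ≡⟨ cong (c *_) (μ≡𝔼-indicator p i 𝒜?) ⟩
  c * F i                                       ≡⟨ +-identityʳ _ ⟨
  c * F i + 0ℚ                                  ≤⟨ +-monoʳ-≤ (c * F i) (0≤𝔼 i N≤i) ⟩
  c * F i + (seq (𝔼 p excess) i + ε)            ≡⟨ cong (λ e → c * F i + (e + ε)) (𝔼-linear p i 1ℚ (- c) (thin f) f) ⟩
  c * F i + (1ℚ * G i + - c * F i + ε)          ≡⟨ cancel c (F i) (G i) ε ⟩
  G i + ε                                       ≡⟨ cong (_+ ε) (𝔼-thin p i f) ⟨
  seq (𝔼 (p *ᵣ fromℚ ½) f) i + ε                ≡⟨ cong (_+ ε) (μ≡𝔼-indicator (p *ᵣ fromℚ ½) i 𝒜?) ⟨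
  seq (μ (p *ᵣ fromℚ ½) 𝒜?) i + ε               ∎
  where
  c = constant k
  f = indicator 𝒜?
  F G : ℕ → ℚ
  F i = seq (𝔼 p f) i
  G i = seq (𝔼 p (thin f)) i
  excess : Subset (suc n) → ℚ
  excess S = 1ℚ * thin f S + - c * f S
  0≤excess : ∀ S → 0ℚ ℚ.≤ excess S
  0≤excess S = subst (0ℚ ℚ.≤_) (rearrange (thin f S) c (f S))
    (p≤q⇒0≤q-p (constant*indicator≤thin k 𝒜? mono small S))
    where
    rearrange : ∀ g c f → g - c * f ≡ 1ℚ * g + - c * f
    rearrange = solve 3 (λ g c f → g :- c :* f := con 1ℚ :* g :+ :- c :* f) refl
      where open +-*-Solver
  cancel : ∀ c F G ε → c * F + (1ℚ * G + - c * F + ε) ≡ G + ε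
  cancel = solve 4 (λ c F G ε → c :* F :+ (con 1ℚ :* G :+ :- c :* F :+ ε) := G :+ ε) refl
    where open +-*-Solver
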